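{- Let $\mathbf P=(P,x_L,x_R)$ be an oriented poset with vertex weights $w$. The weight matrices corresponding to the target loops $\lhd(\mathbf P\!\searrow)$ and $\lhd(\mathbf P\!\nearrow)$ are given by $$\mathcal M_w\big((\lhd(\mathbf P\!\searrow))\!\searrow\big)=\mathrm{loop}_t\big(\mathcal M_w(\mathbf P\!\searrow)\big),\qquad \mathcal M_w\big((\lhd(\mathbf P\!\nearrow))\!\searrow\big)=\mathrm{loop}_t\big(\mathcal M_w(\mathbf P\!\nearrow)\big),$$ where $$\mathrm{loop}_t\begin{bmatrix}a&b\\c&d\end{bmatrix}=\begin{bmatrix}a+d&c-a\\c+d&0\end{bmatrix}.$$
   Context: An oriented poset $\mathbf P=(P,x_L,x_R)$ is a finite poset $P$ with two specified vertices $x_L$ (left, or target vertex) and $x_R$ (right, or source vertex), possibly equal. Each vertex $i$ of $P$ carries a weight variable $w_i$. An order ideal is a down-closed subset, $J(P)$ is the set of order ideals, and $\mathcal W(P;w)=\sum_{I\in J(P)}\prod_{i\in I}w_i$ is the weight polynomial. A restriction such as $\mathcal W(\mathbf P;w)|_{x_R\in I,\,x_L\notin I}$ means that the sum is only over ideals $I$ satisfying the stated conditions. Down-pointing weight matrix: $$\mathcal M_w(\mathbf P\!\searrow)=\begin{bmatrix}\mathcal W(\mathbf P;w)&-\mathcal W(\mathbf P;w)|_{x_R\in I}\\ \mathcal W(\mathbf P;w)|_{x_L\notin I}&-\mathcal W(\mathbf P;w)|_{x_R\in I,\,x_L\notin I}\end{bmatrix}.$$ Up-pointing weight matrix: $$\mathcal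 M_w(\mathbf P\!\nearrow)=\begin{bmatrix}\mathcal W(\mathbf P;w)|_{x_R\in I}&\mathcal W(\mathbf P;w)|_{x_R\notin I}\\ \mathcal W(\mathbf P;w)|_{x_R\in I,\,x_L\notin I}&\mathcal W(\mathbf P;w)|_{x_R\notin I,\,x_L\notin I}\end{bmatrix}.$$ $\circlearrowright(\mathbf P\!\searrow)$ denotes the poset obtained from $P$ by adding the relation $x_L\preceq x_R$, and $\circlearrowright(\mathbf P\!\nearrow)$ the poset obtained by adding the relation $x_L\succeq x_R$ (in both cases taking the transitive closure, which is understood to be again a partial order). The target loops are the oriented posets $\lhd(\mathbf P\!\searrow)=(\circlearrowright(\mathbf P\!\searrow),x_L,x_L)$ and $\lhd(\mathbf P\!\nearrow)=(\circlearrowright(\mathbf P\!\nearrow),x_L,x_L)$, whose target and source vertices are both $x_L$. -}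

module Defs where

open import Algebra.Bundles using (CommutativeRing)
open import Data.Fin.Base using (Fin)
open import Data.Fin.Properties using (all?)
open import Data.Fin.Subset using (Subset; inside; outside; _∈_; _∉_)
open import Data.Fin.Subset.Properties using (_∈?_)
open import Data.List.Base using (List; []; _∷_; _++_; map; filter; foldr; allFin)
open import Data.Nat.Base using (ℕ; zero; suc)
open import Data.Product.Base using (_×_; _,_)
open import Data.Sum.Base using (_⊎_; inj₁; inj₂)
open import Data.Vec.Base using (Vec; []; _∷_)
open import Data.Vec.Relation.Binary.Pointwise.Inductive using (Pointwise)
open import Level using (0ℓ; _⊔_)
open import Relation.Binary.Construct.Closure.Transitive
  using (TransClosure; [_]; _∷_; transitive)
open import Relation.Binary.Core using (Rel)
open import Relation.Binary.Definitions using (Antisymmetric) renaming (Decidable to Decidable₂)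
open import Relation.Binary.PropositionalEquality using (_≡_; refl; isEquivalence)
open import Relation.Binary.Structures using (IsDecPartialOrder)
open import Relation.Nullary.Decidable using (map′; ¬?; _×-dec_; _⊎-dec_; _→-dec_)
open import Relation.Unary using (Pred; Decidable)

-- A finite poset, with its n vertices labelled by Fin n.

record FinPoset (n : ℕ) : Set₁ where
  infix 4 _⊑_
  field
    _⊑_               : Rel (Fin n) 0ℓ
    isDecPartialOrder : IsDecPartialOrder _≡_ _⊑_

  open IsDecPartialOrder isDecPartialOrder public
    using () renaming (_≟_ to _≟ᵥ_; _≤?_ to _⊑?_; refl to ⊑-refl; trans to ⊑-trans)

record OrientedPoset (n : ℕ) : Set₁ where
  field
    poset : FinPoset n
    xL xR : Fin n

  open FinPoset poset public

-- Every subset of Fin n, listed exactly once.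
subsets : ∀ n → List (Subset n)
subsets zero    = [] ∷ []
subsets (suc n) = map (outside ∷_) (subsets n) ++ map (inside ∷_) (subsets n)

module _ {n} (P : FinPoset n) where
  open FinPoset P

  IsIdeal : Pred (Subset n) 0ℓ
  IsIdeal I = ∀ i j → i ⊑ j → j ∈ I → i ∈ I

  isIdeal? : Decidable IsIdeal
  isIdeal? I = all? λ i → all? λ j → (i ⊑? j) →-dec ((j ∈? I) →-dec (i ∈? I))

  J : List (Subset n)
  J = filter isIdeal? (subsets n)

module _ {n} (P : FinPoset n) (u v : Fin n) where
  open FinPoset P

  Extend : Rel (Fin n) 0ℓ
  Extend = TransClosure (λ i j → i ⊑ j ⊎ (i ≡ u × j ≡ v))

  private
    Extend′ : Rel (Fin n) 0ℓ
    Extend′ i j = i ⊑ j ⊎ (i ⊑ u × v ⊑ j)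

    from : ∀ {i j} → Extend′ i j → Extend i j
    from (inj₁ i⊑j)         = [ inj₁ i⊑j ]
    from (inj₂ (i⊑u , v⊑j)) = inj₁ i⊑u ∷ inj₂ (refl , refl) ∷ [ inj₁ v⊑j ]

    to : ∀ {i j} → Extend i j → Extend′ i j
    to [ inj₁ i⊑j ]           = inj₁ i⊑j
    to [ inj₂ (refl , refl) ] = inj₂ (⊑-refl , ⊑-refl)
    to (inj₁ i⊑k ∷ k⁺j) with to k⁺j
    ... | inj₁ k⊑j         = inj₁ (⊑-trans i⊑k k⊑j)
    ... | inj₂ (k⊑u , v⊑j) = inj₂ (⊑-trans i⊑k k⊑u , v⊑j)
    to (inj₂ (refl , refl) ∷ v⁺j) with to v⁺j
    ... | inj₁ v⊑j       = inj₂ (⊑-refl , v⊑j)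
    ... | inj₂ (_ , v⊑j) = inj₂ (⊑-refl , v⊑j)

  extend? : Decidable₂ Extend
  extend? i j = map′ from to ((i ⊑? j) ⊎-dec ((i ⊑? u) ×-dec (v ⊑? j)))

  extend : Antisymmetric _≡_ Extend → FinPoset n
  extend antisym = record
    { _⊑_               = Extend
    ; isDecPartialOrder = record
      { isPartialOrder = record
        { isPreorder = record
          { isEquivalence = isEquivalence
          ; reflexive     = λ { refl → [ inj₁ ⊑-refl ] }
          ; trans         = transitive _
          }
        ; antisym = antisym
        }
      ; _≟_  = _≟ᵥ_
      ; _≤?_ = extend?
      }
    }

module _ {n} (P : OrientedPoset n) where
  open OrientedPoset P

  -- The added relation leaves a partial order: x_L ⪯ x_R for ↘, x_R ⪯ x_L for ↗.
  Loopable↘ Loopable↗ : Set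
  Loopable↘ = Antisymmetric _≡_ (Extend poset xL xR)
  Loopable↗ = Antisymmetric _≡_ (Extend poset xR xL)

  ↻↘ : Loopable↘ → FinPoset n
  ↻↘ = extend poset xL xR

  ↻↗ : Loopable↗ → FinPoset n
  ↻↗ = extend poset xR xL

  ◁↘ : Loopable↘ → OrientedPoset n
  ◁↘ po = record { poset = ↻↘ po ; xL = xL ; xR = xL }

  ◁↗ : Loopable↗ → OrientedPoset n
  ◁↗ po = record { poset = ↻↗ po ; xL = xL ; xR = xL }

module _ {n} (P : OrientedPoset n) where
  open OrientedPoset P

  xR∈? : Decidable (λ I → xR ∈ I)
  xR∈? I = xR ∈? I

  xR∉? : Decidable (λ I → xR ∉ I)
  xR∉? I = ¬? (xR ∈? I)

  xL∉? : Decidable (λ I → xL ∉ I)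
  xL∉? I = ¬? (xL ∈? I)

  xR∈,xL∉? : Decidable (λ I → xR ∈ I × xL ∉ I)
  xR∈,xL∉? I = xR∈? I ×-dec xL∉? I

  xR∉,xL∉? : Decidable (λ I → xR ∉ I × xL ∉ I)
  xR∉,xL∉? I = xR∉? I ×-dec xL∉? I

-- The weights take values in an arbitrary commutative ring; taking the ring
-- ℤ[w₁,…,wₙ] and its generators gives the identities between polynomials.

module Weights {c ℓ} (R : CommutativeRing c ℓ) where
  open CommutativeRing R using (Carrier; _≈_; _+_; _*_; _-_; -_; 0#; 1#)

  Matrix₂ : Set c
  Matrix₂ = Vec (Vec Carrier 2) 2

  infix 4 _≋_
  _≋_ : Rel Matrix₂ (c ⊔ ℓ)
  _≋_ = Pointwise (Pointwise _≈_)

  loopₜ : Matrix₂ → Matrix₂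
  loopₜ ((a ∷ b ∷ []) ∷
         (c ∷ d ∷ []) ∷ []) = (a + d ∷ c - a ∷ []) ∷
                              (c + d ∷ 0#    ∷ []) ∷ []

  module _ {n} (w : Fin n → Carrier) where

    weight : Subset n → Carrier
    weight I = foldr _*_ 1# (map w (filter (_∈? I) (allFin n)))

    sumWeights : List (Subset n) → Carrier
    sumWeights Is = foldr _+_ 0# (map weight Is)

    𝓦 : FinPoset n → Carrier
    𝓦 P = sumWeights (J P)

    𝓦∣ : FinPoset n → {C : Pred (Subset n) 0ℓ} → Decidable C → Carrier
    𝓦∣ P C? = sumWeights (filter C? (J P))

    module _ (P : OrientedPoset n) where
      open OrientedPoset P using (poset)

      𝓜↘ : Matrix₂
      𝓜↘ = (𝓦  poset           ∷ - 𝓦∣ poset (xR∈? P)     ∷ []) ∷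
           (𝓦∣ poset (xL∉? P)  ∷ - 𝓦∣ poset (xR∈,xL∉? P) ∷ []) ∷ []

      𝓜↗ : Matrix₂
      𝓜↗ = (𝓦∣ poset (xR∈? P)     ∷ 𝓦∣ poset (xR∉? P)     ∷ []) ∷
           (𝓦∣ poset (xR∈,xL∉? P) ∷ 𝓦∣ poset (xR∉,xL∉? P) ∷ []) ∷ []

{-# OPTIONS --safe #-}
-- The ideals of the poset obtained by adding u ⪯ v are the ideals I of P with
-- v ∈ I → u ∈ I, so every entry of either side is a sum over the ideals of P
-- subject to a condition on x_L and x_R; the entries are then compared by
-- splitting such a condition into two disjoint ones.
module Submission where

open import Algebra.Bundles using (CommutativeRing)
import Algebra.Properties.AbelianGroup as AbelianGroupProperties
import Algebra.Properties.CommutativeSemigroup as CommutativeSemigroupProperties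
open import Data.Empty using (⊥-elim)
open import Data.Fin.Base using (Fin)
open import Data.Fin.Subset using (Subset; _∈_)
open import Data.Fin.Subset.Properties using (_∈?_)
open import Data.List.Base using ([]; _∷_; filter)
open import Data.List.Properties using (filter-accept; filter-reject; filter-all; filter-none)
open import Data.List.Relation.Unary.All using (universal)
open import Data.Nat.Base using (ℕ)
open import Data.Product.Base using (_×_; _,_; proj₁; proj₂)
open import Data.Sum.Base as Sum using (inj₁; inj₂; [_,_]′)
open import Data.Unit.Base using (tt)
open import Data.Vec.Relation.Binary.Pointwise.Inductive using ([]; _∷_)
open import Function.Base using (_∘_; const; id)
open import Level using (0ℓ; Level)
open import Relation.Binary.Construct.Closure.Transitive using ([_]; _∷_)
open import Relation.Binary.Definitions using (Antisymmetric)
open import Relation.Binary.PropositionalEquality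
  using (_≡_; refl; sym; trans; cong; subst)
open import Relation.Nullary.Decidable using (yes; no; toSum; _→-dec_)
open import Relation.Unary
  using (Pred; Decidable; Universal; Empty; _∩_; _∪_; _≐_; _⊆_; _⊥_)
open import Relation.Unary.Properties using (U?; _∩?_)

open import Defs

private variable
  a p q r : Level
  A : Set a

-- `S?` may be any decision procedure for the conjunction, so that it can be `isIdeal?` of the
-- extended poset, which is not built from `P?` and `Q?`.
filter-filter : {P : Pred A p} {Q : Pred A q} {S : Pred A r}
  (P? : Decidable P) (Q? : Decidable Q) (S? : Decidable S) → S ≐ P ∩ Q →
  ∀ xs → filter P? (filter Q? xs) ≡ filter S? xs
filter-filter P? Q? S? S≐P∩Q [] = refl
filter-filter P? Q? S? S≐P∩Q@(S⊆ , ⊆S) (x ∷ xs) with Q? x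
... | no ¬q = trans (filter-filter P? Q? S? S≐P∩Q xs)
                    (sym (filter-reject S? λ s → ¬q (proj₂ (S⊆ s))))
... | yes q with P? x
...   | yes p = trans (cong (x ∷_) (filter-filter P? Q? S? S≐P∩Q xs))
                      (sym (filter-accept S? (⊆S (p , q))))
...   | no ¬p = trans (filter-filter P? Q? S? S≐P∩Q xs)
                      (sym (filter-reject S? λ s → ¬p (proj₁ (S⊆ s))))

module _ {n} (u v : Fin n) where

  Closed : Pred (Subset n) 0ℓ
  Closed I = v ∈ I → u ∈ I

  closed? : Decidable Closed
  closed? I = (v ∈? I) →-dec (u ∈? I)

module _ {n} (P : FinPoset n) (u v : Fin n) (po : Antisymmetric _≡_ (Extend P u v)) where

  -- One-link chains give both conditions. Conversely, membership is carried down a chain from its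
  -- upper end: links of `P` use `ideal`, and the added link uses `closed`.
  isIdeal-extend : IsIdeal (extend P u v po) ≐ Closed u v ∩ IsIdeal P
  isIdeal-extend = to , λ (closed , ideal) → from closed ideal
    where
    to : IsIdeal (extend P u v po) ⊆ Closed u v ∩ IsIdeal P
    to ideal = ideal u v [ inj₂ (refl , refl) ] ,
               λ i j i⊑j → ideal i j [ inj₁ i⊑j ]

    from : ∀ {I} → Closed u v I → IsIdeal P I → IsIdeal (extend P u v po) I
    from closed ideal i j [ inj₁ i⊑j ] j∈I = ideal i j i⊑j j∈I
    from closed ideal _ _ [ inj₂ (refl , refl) ] v∈I = closed v∈I
    from closed ideal i j (inj₁ i⊑k ∷ k⁺j) j∈I =
      ideal i _ i⊑k (from closed ideal _ j k⁺j j∈I)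
    from closed ideal _ j (inj₂ (refl , refl) ∷ v⁺j) j∈I =
      closed (from closed ideal v j v⁺j j∈I)

  -- An equality of lists, since both sides filter the same enumeration `subsets n`; no reordering
  -- of sums is needed later.
  J-extend : J (extend P u v po) ≡ filter (closed? u v) (J P)
  J-extend = sym (filter-filter (closed? u v) (isIdeal? P)
    (isIdeal? (extend P u v po)) isIdeal-extend (subsets n))

module _ {c ℓ} (R : CommutativeRing c ℓ) where
  open CommutativeRing R
    using (Carrier; _≈_; _+_; _-_; -_; 0#; -‿cong; +-congˡ; +-congʳ; +-assoc; +-identityˡ;
           +-abelianGroup; reflexive)
    renaming (sym to ≈-sym; trans to ≈-trans)
  open AbelianGroupProperties +-abelianGroup
    using (//-rightDividesʳ; \\-leftDividesˡ; ⁻¹-∙-comm; ε⁻¹≈ε)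
  open CommutativeSemigroupProperties
    (CommutativeRing.+-commutativeSemigroup R) using (x∙yz≈y∙xz)
  open Weights R

  x≈y+z⇒y≈x-z : ∀ {x y z} → x ≈ y + z → y ≈ x - z
  x≈y+z⇒y≈x-z {y = y} {z} x≈y+z =
    ≈-trans (≈-sym (//-rightDividesʳ z y)) (+-congʳ (≈-sym x≈y+z))

  -- Serves the upper right entry, which carries a minus sign on the left-hand side and has the form
  -- c - a on the right.
  x≈y+z⇒-z≈y-x : ∀ {x y z} → x ≈ y + z → - z ≈ y - x
  x≈y+z⇒-z≈y-x {y = y} {z} x≈y+z = ≈-trans (≈-sym (\\-leftDividesˡ y (- z)))
    (+-congˡ (≈-trans (⁻¹-∙-comm y z) (-‿cong (≈-sym x≈y+z))))

  module _ {n} (w : Fin n → Carrier) where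

    sumWeights-∪ : {A B C : Pred (Subset n) 0ℓ}
      (A? : Decidable A) (B? : Decidable B) (C? : Decidable C) →
      A ⊥ B → C ≐ A ∪ B → ∀ Is →
      sumWeights w (filter C? Is) ≈ sumWeights w (filter A? Is) + sumWeights w (filter B? Is)
    sumWeights-∪ A? B? C? A⊥B C≐A∪B [] = ≈-sym (+-identityˡ 0#)
    sumWeights-∪ A? B? C? A⊥B C≐A∪B@(C⊆ , ⊆C) (I ∷ Is)
      with ih ← sumWeights-∪ A? B? C? A⊥B C≐A∪B Is | A? I | B? I | C? I
    ... | yes a | yes b | _     = ⊥-elim (A⊥B (a , b))
    ... | yes a | no _  | yes _ = ≈-trans (+-congˡ ih) (≈-sym (+-assoc _ _ _))
    ... | yes a | no _  | no ¬c = ⊥-elim (¬c (⊆C (inj₁ a)))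
    -- The weight of `I` has to move past the sum over `A?` to reach the sum over `B?`.
    ... | no _  | yes b | yes _ = ≈-trans (+-congˡ ih) (x∙yz≈y∙xz _ _ _)
    ... | no _  | yes b | no ¬c = ⊥-elim (¬c (⊆C (inj₂ b)))
    ... | no ¬a | no ¬b | yes c = ⊥-elim ([ ¬a , ¬b ]′ (C⊆ c))
    ... | no _  | no _  | no _  = ih

    module _ (P : FinPoset n) where

      𝓦∣-∪ : {A B C : Pred (Subset n) 0ℓ}
        (A? : Decidable A) (B? : Decidable B) (C? : Decidable C) →
        A ⊥ B → C ≐ A ∪ B → 𝓦∣ w P C? ≈ 𝓦∣ w P A? + 𝓦∣ w P B?
      𝓦∣-∪ A? B? C? A⊥B C≐A∪B = sumWeights-∪ A? B? C? A⊥B C≐A∪B (J P)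

      𝓦≈𝓦∣+𝓦∣ : {A B : Pred (Subset n) 0ℓ} (A? : Decidable A) (B? : Decidable B) →
        A ⊥ B → Universal (A ∪ B) → 𝓦 w P ≈ 𝓦∣ w P A? + 𝓦∣ w P B?
      𝓦≈𝓦∣+𝓦∣ A? B? A⊥B A∪B = ≈-trans
        -- The unrestricted sum is read as the restriction to the always true condition `U?`.
        (reflexive (cong (sumWeights w) (sym (filter-all U? (universal (λ _ → tt) (J P))))))
        (𝓦∣-∪ A? B? U? A⊥B ((λ {I} _ → A∪B I) , _))

      𝓦∣-Empty : {A : Pred (Subset n) 0ℓ} (A? : Decidable A) → Empty A → 𝓦∣ w P A? ≈ 0#
      𝓦∣-Empty A? ¬A = reflexive (cong (sumWeights w) (filter-none A? (universal ¬A (J P))))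

      module _ (u v : Fin n) (po : Antisymmetric _≡_ (Extend P u v)) where

        𝓦-extend : 𝓦 w (extend P u v po) ≈ 𝓦∣ w P (closed? u v)
        𝓦-extend = reflexive (cong (sumWeights w) (J-extend P u v po))

        𝓦∣-extend : {A : Pred (Subset n) 0ℓ} (A? : Decidable A) →
          𝓦∣ w (extend P u v po) A? ≈ 𝓦∣ w P (A? ∩? closed? u v)
        𝓦∣-extend A? = reflexive (cong (sumWeights w)
          (trans (cong (filter A?) (J-extend P u v po))
            (filter-filter A? (closed? u v) (A? ∩? closed? u v) (id , id) (J P))))

    -- When source and target coincide, the condition of the lower right entry contradicts itself.
    -- Both target loops satisfy the hypothesis by `refl`.
    entry₂₂≈0 : (P : OrientedPoset n) → let open OrientedPoset P in
      xL ≡ xR → - 𝓦∣ w poset (xR∈,xL∉? P) ≈ 0#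
    entry₂₂≈0 P xL≡xR = ≈-trans
      (-‿cong (𝓦∣-Empty (OrientedPoset.poset P) (xR∈,xL∉? P) λ _ (r , ¬l) →
        ¬l (subst (_∈ _) (sym xL≡xR) r))) ε⁻¹≈ε

    module _ (P : OrientedPoset n) where
      open OrientedPoset P

      𝓜↘-◁↘ : (po : Loopable↘ P) → 𝓜↘ w (◁↘ P po) ≋ loopₜ (𝓜↘ w P)
      𝓜↘-◁↘ po =
        (≈-trans (𝓦-extend poset xL xR po)
           -- The ideals failing `K?` are those containing `xR` but not `xL`; their total weight is
           -- -d, so subtracting it gives a + d.
           (x≈y+z⇒y≈x-z (𝓦≈𝓦∣+𝓦∣ poset K? (xR∈,xL∉? P)
             (λ (k , r , ¬l) → ¬l (k r))
             (λ I → [ inj₁ ∘ const , (λ ¬l → [ (λ r → inj₂ (r , ¬l)) ,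
                      (λ ¬r → inj₁ (⊥-elim ∘ ¬r)) ]′ (toSum (xR ∈? I))) ]′ (toSum (xL ∈? I))))) ∷
         -- The source of the loop is `xL`, so this entry asks for `xL ∈ I`, which already implies
         -- `K?`; the complement is `xL ∉ I`.
         ≈-trans (-‿cong (𝓦∣-extend poset xL xR po (xL ∈?_)))
           (x≈y+z⇒-z≈y-x (𝓦≈𝓦∣+𝓦∣ poset (xL∉? P) ((xL ∈?_) ∩? K?)
             (λ (¬l , l , _) → ¬l l)
             (λ I → [ (λ l → inj₂ (l , const l)) , inj₁ ]′ (toSum (xL ∈? I))))) ∷ []) ∷
        (≈-trans (𝓦∣-extend poset xL xR po (xL∉? P))
           -- Among ideals avoiding `xL`, those violating `K?` contain `xR`; removing them from c
           -- again adds d.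
           (x≈y+z⇒y≈x-z (𝓦∣-∪ poset (xL∉? P ∩? K?) (xR∈,xL∉? P) (xL∉? P)
             (λ ((_ , k) , r , ¬l) → ¬l (k r))
             ((λ {I} ¬l → [ (λ r → inj₂ (r , ¬l)) , (λ ¬r → inj₁ (¬l , ⊥-elim ∘ ¬r)) ]′
                            (toSum (xR ∈? I))) ,
              [ proj₁ , proj₂ ]′))) ∷
         entry₂₂≈0 (◁↘ P po) refl ∷ []) ∷ []
        where K? = closed? xL xR

      𝓜↘-◁↗ : (po : Loopable↗ P) → 𝓜↘ w (◁↗ P po) ≋ loopₜ (𝓜↗ w P)
      𝓜↘-◁↗ po =
        (≈-trans (𝓦-extend poset xR xL po)
           -- Here `K?` says that `xL ∈ I` forces `xR ∈ I`: either `xR` is in `I`, or both vertices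
           -- are missing. These are a and d, now without signs.
           (𝓦∣-∪ poset (xR∈? P) (xR∉,xL∉? P) K?
             (λ (r , ¬r , _) → ¬r r)
             ((λ {I} k → Sum.map₂ (λ ¬r → ¬r , ¬r ∘ k) (toSum (xR ∈? I))) ,
              [ const , (λ (_ , ¬l) → ⊥-elim ∘ ¬l) ]′)) ∷
         ≈-trans (-‿cong (𝓦∣-extend poset xR xL po (xL ∈?_)))
           -- Given `K?`, containing `xL` amounts to containing both vertices, so a splits according
           -- to whether `xL` lies in `I`.
           (x≈y+z⇒-z≈y-x (𝓦∣-∪ poset (xR∈,xL∉? P) ((xL ∈?_) ∩? K?) (xR∈? P)
             (λ ((_ , ¬l) , l , _) → ¬l l)
             ((λ {I} r → [ (λ l → inj₂ (l , const r)) , (λ ¬l → inj₁ (r , ¬l)) ]′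
                           (toSum (xL ∈? I))) ,
              [ proj₁ , (λ (l , k) → k l) ]′))) ∷ []) ∷
        (≈-trans (𝓦∣-extend poset xR xL po (xL∉? P))
           -- `K?` holds vacuously when `xL ∉ I`, so only the split on `xR` remains.
           (𝓦∣-∪ poset (xR∈,xL∉? P) (xR∉,xL∉? P) (xL∉? P ∩? K?)
             (λ ((r , _) , ¬r , _) → ¬r r)
             ((λ {I} (¬l , _) → Sum.map (_, ¬l) (_, ¬l) (toSum (xR ∈? I))) ,
              [ (λ (_ , ¬l) → ¬l , ⊥-elim ∘ ¬l) , (λ (_ , ¬l) → ¬l , ⊥-elim ∘ ¬l) ]′)) ∷
         entry₂₂≈0 (◁↗ P po) refl ∷ []) ∷ []
        where K? = closed? xR xL

theorem5p6 : ∀ {c ℓ} (R : CommutativeRing c ℓ) → let open Weights R in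
    ∀ {n : ℕ} (P : OrientedPoset n) (w : Fin n → CommutativeRing.Carrier R) →
    ((po : Loopable↘ P) → 𝓜↘ w (◁↘ P po) ≋ loopₜ (𝓜↘ w P)) ×
    ((po : Loopable↗ P) → 𝓜↘ w (◁↗ P po) ≋ loopₜ (𝓜↗ w P))
theorem5p6 R P w = 𝓜↘-◁↘ R w P , 𝓜↘-◁↗ R w P
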